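{- For every $\mathrm{PastCTL}_\pm$ formula $\varphi$ over a set $AP$ of atomic propositions there is a two-way linear $\mathrm{HTA}_\pm$ $\mathcal{A}_\varphi$ over $\Sigma=2^{AP}$ such that $\mathcal{L}(\varphi)=\mathcal{L}(\mathcal{A}_\varphi)$.
   Context: Fix a finite set $AP$, $\Sigma=2^{AP}$. A $\Sigma$-tree is an unranked (finitely many children per node), unordered, leafless (every node has a child) tree with labelling $t(v)\in\Sigma$. $\mathrm{PastCTL}_\pm$ formulae: $\varphi ::= p\mid\neg\varphi\mid\varphi\lor\varphi\mid\mathsf{D}^n\varphi\mid\mathsf{E}\mathsf{X}\varphi\mid\mathsf{E}(\varphi\,\mathsf{U}\,\varphi)\mid\mathsf{E}\mathsf{Y}\varphi\mid\mathsf{E}(\varphi\,\mathsf{S}\,\varphi)$, evaluated at a node $u$: $p$ iff $p\in t(u)$; Booleans as usual; $\mathsf{D}^n\varphi$ iff $u$ has at least $n$ distinct children satisfying $\varphi$; $\mathsf{E}\mathsf{X}\varphi$ iff some child of $u$ satisfies $\varphi$; $\mathsf{E}(\varphi_1\mathsf{U}\varphi_2)$ iff there is a downward path $u=v_0,\dots,v_j$ with $v_j\models\varphi_2$ and $v_k\models\varphi_1$ for $k<j$; $\mathsf{E}\mathsf{Y}\varphi$ iff $u$ is not the root and its parent satisfies $\varphi$; $\mathsf{E}(\varphi_1\mathsf{S}\varphi_2)$ iff for some $j\ge0$ the ancestors $w_0=u$, $w_{k+1}=$ parent of $w_k$ exist up to $w_j$, $w_j\models\varphi_2$ and $w_k\models\varphi_1$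 for $k<j$. $\mathcal{L}(\varphi)$ is the set of trees whose root satisfies $\varphi$. A two-way $\mathrm{HTA}_\pm$ is $\mathcal{A}=\langle Q,\Sigma,\delta,q_I,F\rangle$ with $Q$ finite, $q_I\in Q$, $F\subseteq Q$, $\delta:Q\times\Sigma\times\{\mathit{root},\mathit{nonroot}\}\to\mathcal{B}^+(\{\Diamond_k,\Box_k\}_{k\in\mathbb{N}}\times Q\cup\{\Uparrow\}\times Q)$ (positive Boolean formulae over these atoms, built with $\top,\bot,\land,\lor$); $\Diamond=\Diamond_1,\Box=\Box_1$. A run on $t$ from $s$ is a tree $r$ labelled by $Q\times\mathrm{Dom}(t)$, root labelled $(q_I,s)$, each node $x$ labelled $(q,v)$ satisfying $\delta(q,t(v),\rho)$ ($\rho=\mathit{root}$ iff $v$ is the root), where $x\models(\Diamond_k,q')$ iff $x$ has children labelled $(q',v_1),\dots,(q',v_k)$ for pairwise distinct children $v_i$ of $v$; $x\models(\Box_k,q')$ iff for all but at most $k-1$ children $v'$ of $v$, $x$ has a child labelled $(q',v')$; $x\models(\Uparrow,q')$ iff $x$ has a child labelled $(q',v')$ with $v'$ the parent of $v$. Accepting: every infinite path of $r$ from its root has infinitely many nodes with state in $F$. $\mathcal{L}(\mathcal{A})$: trees with an accepting run from the root. Hesitant: a partition of $Q$ into nonempty components, totally ordered so that transitions from $Q_i$ only mention states of components $Q_j$ with $j\le i$, each component being of exactly one type: transient (no atom with state in $Q_i$ occurs in $\delta(q,\sigma,\rho)$ for $q\in Q_i$); existential ($Q_i$-atoms in such transitions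 are of form $(\Diamond,q')$, at most one per DNF clause); universal ($Q_i$-atoms of form $(\Box,q')$, at most one per CNF clause); upward (singleton $\{q\}$ with $q$ occurring in $\delta(q,\sigma,\rho)$ only as $(\Uparrow,q)$). Polarised: existential-component states not in $F$, universal-component states in $F$. Linear: all components are singletons. -}

module Defs where

open import Data.Empty using (⊥)
open import Data.Fin.Base using (Fin) renaming (_≤_ to _≤ᶠ_)
open import Data.Fin.Properties using (_≟_)
open import Data.Fin.Subset using (Subset) renaming (_∈_ to _∈ˢ_; _∉_ to _∉ˢ_)
open import Data.List.Base using (List; []; _∷_; _++_; length; filter; cartesianProductWith)
open import Data.List.Membership.Propositional using (_∈_; _∉_)
open import Data.List.Relation.Unary.All using (All)
open import Data.Nat.Base using (ℕ; zero; suc; _≤_; _<_)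
open import Data.Product.Base using (Σ; Σ-syntax; ∃-syntax; _×_; _,_; proj₁; proj₂)
open import Data.Sum.Base using (_⊎_)
open import Data.Unit.Base using (⊤)
open import Function.Base using (flip)
open import Function.Bundles using (_⇔_)
open import Function.Definitions using (Injective; Surjective)
open import Level using (0ℓ) renaming (suc to lsuc)
open import Relation.Binary.Construct.Closure.ReflexiveTransitive using (Star; ε; _◅_)
open import Relation.Binary.Core using (Rel)
open import Relation.Binary.PropositionalEquality using (_≡_; refl)
open import Relation.Nullary using (¬_; Dec; yes; no)
open import Relation.Unary using (Pred)

-- Rooted trees, of arbitrary branching and possibly with leaves.
-- `u ⟶ v` says that v is a child of u.
record Tree : Set₁ where
  infix 4 _⟶_
  field
    Node          : Set
    root          : Node
    _⟶_           : Rel Node 0ℓ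
    root-orphan   : ∀ {u} → ¬ (u ⟶ root)
    parent-unique : ∀ {u u′ v} → u ⟶ v → u′ ⟶ v → u ≡ u′
    reachable     : ∀ v → Star _⟶_ root v

  private
    nonempty-path : ∀ {u w v} → u ⟶ w → Star _⟶_ w v → ¬ (v ≡ root)
    nonempty-path e ε        refl = root-orphan e
    nonempty-path _ (e ◅ es) eq   = nonempty-path e es eq

  root? : ∀ v → Dec (v ≡ root)
  root? v with reachable v
  ... | ε      = yes refl
  ... | e ◅ es = no (nonempty-path e es)

-- The finite set AP is Fin n, and Σ = 2^AP is Subset n.  The order of the list
-- `children u` is never referred to, so the trees are unordered.
record ΣTree (n : ℕ) : Set₁ where
  field
    tree : Tree
  open Tree tree public
  field
    label      : Node → Subset n
    children   : Node → List Node
    ∈-children : ∀ {u v} → u ⟶ v ⇔ v ∈ children u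
    leafless   : ∀ u → ∃[ v ] u ⟶ v

AtLeast : {A : Set} → ℕ → Pred A 0ℓ → Set
AtLeast {A} k P = Σ[ f ∈ (Fin k → A) ] Injective _≡_ _≡_ f × (∀ i → P (f i))

-- "For all but at most k - 1 elements of P, R holds", where E lists the
-- exceptions.  For k = 0 this is false, dually to `AtLeast 0 P` being true.
AllButFewerThan : {A : Set} → ℕ → Pred A 0ℓ → Pred A 0ℓ → Set
AllButFewerThan {A} k P R =
  Σ[ E ∈ List A ] length E < k × (∀ a → P a → a ∉ E → R a)

-- A finite path w₀ = u, …, wⱼ along _⇝_ with R at wⱼ and P at all earlier nodes.
-- Only the values of w at 0, …, j matter.
PathUntil : {A : Set} → Rel A 0ℓ → Pred A 0ℓ → Pred A 0ℓ → Pred A 0ℓ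
PathUntil {A} _⇝_ P R u =
  ∃[ j ] Σ[ w ∈ (ℕ → A) ]
    w 0 ≡ u × (∀ k → k < j → (w k ⇝ w (suc k)) × P (w k)) × R (w j)

data PastCTL± (n : ℕ) : Set where
  prop    : Fin n → PastCTL± n
  neg     : PastCTL± n → PastCTL± n
  _or_    : PastCTL± n → PastCTL± n → PastCTL± n
  D       : ℕ → PastCTL± n → PastCTL± n
  EX      : PastCTL± n → PastCTL± n
  E[_U_]  : PastCTL± n → PastCTL± n → PastCTL± n
  EY      : PastCTL± n → PastCTL± n
  E[_S_]  : PastCTL± n → PastCTL± n → PastCTL± n

module _ {n : ℕ} (t : ΣTree n) where
  open ΣTree t

  Sat : PastCTL± n → Pred Node 0ℓ
  Sat (prop p)   u = p ∈ˢ label u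
  Sat (neg φ)    u = ¬ Sat φ u
  Sat (φ or ψ)   u = Sat φ u ⊎ Sat ψ u
  Sat (D k φ)    u = AtLeast k (λ v → u ⟶ v × Sat φ v)
  Sat (EX φ)     u = ∃[ v ] u ⟶ v × Sat φ v
  Sat E[ φ U ψ ] u = PathUntil _⟶_ (Sat φ) (Sat ψ) u
  Sat (EY φ)     u = ∃[ v ] v ⟶ u × Sat φ v
  Sat E[ φ S ψ ] u = PathUntil (flip _⟶_) (Sat φ) (Sat ψ) u

𝓛-formula : ∀ {n} → PastCTL± n → Pred (ΣTree n) 0ℓ
𝓛-formula φ t = Sat t φ (ΣTree.root t)

data 𝓑⁺ (A : Set) : Set where
  tt ff   : 𝓑⁺ A
  atom    : A → 𝓑⁺ A
  _∧_ _∨_ : 𝓑⁺ A → 𝓑⁺ A → 𝓑⁺ A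

module _ {A : Set} where

  Holds : Pred A 0ℓ → 𝓑⁺ A → Set
  Holds P tt       = ⊤
  Holds P ff       = ⊥
  Holds P (atom a) = P a
  Holds P (b ∧ c)  = Holds P b × Holds P c
  Holds P (b ∨ c)  = Holds P b ⊎ Holds P c

  atoms : 𝓑⁺ A → List A
  atoms tt       = []
  atoms ff       = []
  atoms (atom a) = a ∷ []
  atoms (b ∧ c)  = atoms b ++ atoms c
  atoms (b ∨ c)  = atoms b ++ atoms c

  -- Disjunctive and conjunctive normal forms, by distribution; the inner lists
  -- are the clauses, and repeated atoms in a clause are kept.
  dnf cnf : 𝓑⁺ A → List (List A)
  dnf tt       = [] ∷ []
  dnf ff       = []
  dnf (atom a) = (a ∷ []) ∷ []
  dnf (b ∧ c)  = cartesianProductWith _++_ (dnf b) (dnf c)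
  dnf (b ∨ c)  = dnf b ++ dnf c

  cnf tt       = []
  cnf ff       = [] ∷ []
  cnf (atom a) = (a ∷ []) ∷ []
  cnf (b ∧ c)  = cnf b ++ cnf c
  cnf (b ∨ c)  = cartesianProductWith _++_ (cnf b) (cnf c)

data Position : Set where
  atRoot nonRoot : Position

data Atom (Q : Set) : Set where
  ◇ □ : ℕ → Q → Atom Q
  ⇑   : Q → Atom Q

target : {Q : Set} → Atom Q → Q
target (◇ _ q) = q
target (□ _ q) = q
target (⇑ q)   = q

record TwoWayAutomaton (n : ℕ) : Set where
  field
    size : ℕ
  Q : Set
  Q = Fin size
  field
    δ  : Q → Subset n → Position → 𝓑⁺ (Atom Q)
    qI : Q
    F  : Subset size

module _ {n : ℕ} (t : ΣTree n) where
  open ΣTree t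

  position : Node → Position
  position v with root? v
  ... | yes _ = atRoot
  ... | no  _ = nonRoot

module _ {n : ℕ} (A : TwoWayAutomaton n) (t : ΣTree n) where
  open TwoWayAutomaton A
  open ΣTree t

  record LabelledTree : Set₁ where
    field
      runTree : Tree
    module R = Tree runTree
    field
      runLabel : R.Node → Q × Node

    state : R.Node → Q
    state x = proj₁ (runLabel x)

    node : R.Node → Node
    node x = proj₂ (runLabel x)

    HasChild : R.Node → Q → Node → Set
    HasChild x q v = ∃[ y ] (x R.⟶ y) × runLabel y ≡ (q , v)

    _⊨_ : R.Node → Atom Q → Set
    x ⊨ ◇ k q = AtLeast k (λ v → node x ⟶ v × HasChild x q v)
    x ⊨ □ k q = AllButFewerThan k (node x ⟶_) (HasChild x q)
    x ⊨ ⇑ q   = ∃[ v ] v ⟶ node x × HasChild x q v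

  record Run (s : Node) : Set₁ where
    field
      labelledTree : LabelledTree
    open LabelledTree labelledTree public
    field
      root-label : runLabel R.root ≡ (qI , s)
      consistent : ∀ x →
        Holds (x ⊨_) (δ (state x) (label (node x)) (position t (node x)))

  Accepting : ∀ {s} → Run s → Set
  Accepting r =
    ∀ (π : ℕ → R.Node) → π 0 ≡ R.root → (∀ i → π i R.⟶ π (suc i)) →
    ∀ i → ∃[ j ] i ≤ j × state (π j) ∈ˢ F
    where open Run r

𝓛-automaton : ∀ {n} → TwoWayAutomaton n → Pred (ΣTree n) (lsuc 0ℓ)
𝓛-automaton A t = Σ[ r ∈ Run A t (ΣTree.root t) ] Accepting A t r

data Kind : Set where
  transient existential universal upward : Kind

-- The components are the fibres of the surjection `component`, ordered by index.
-- A component without internal atoms meets the constraints of several kinds;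
-- `kind` designates the one it is taken to have.
record Components {n : ℕ} (A : TwoWayAutomaton n) : Set where
  open TwoWayAutomaton A
  field
    #components : ℕ
    component   : Q → Fin #components
    nonempty    : Surjective _≡_ _≡_ component
    kind        : Fin #components → Kind

  internal : Fin #components → List (Atom Q) → List (Atom Q)
  internal i = filter (λ a → component (target a) ≟ i)

  WellFormed : Kind → Fin #components → 𝓑⁺ (Atom Q) → Set
  WellFormed transient   i b = internal i (atoms b) ≡ []
  WellFormed existential i b =
    All (λ a → a ≡ ◇ 1 (target a)) (internal i (atoms b)) ×
    All (λ clause → length (internal i clause) ≤ 1) (dnf b)
  WellFormed universal   i b =
    All (λ a → a ≡ □ 1 (target a)) (internal i (atoms b)) ×
    All (λ clause → length (internal i clause) ≤ 1) (cnf b)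
  WellFormed upward      i b =
    (∀ q q′ → component q ≡ i → component q′ ≡ i → q ≡ q′) ×
    All (λ a → a ≡ ⇑ (target a)) (internal i (atoms b))

record Hesitant {n : ℕ} (A : TwoWayAutomaton n) : Set where
  open TwoWayAutomaton A
  field
    components : Components A
  open Components components public
  field
    descending : ∀ q σ ρ →
      All (λ a → component (target a) ≤ᶠ component q) (atoms (δ q σ ρ))
    wellFormed : ∀ q σ ρ →
      WellFormed (kind (component q)) (component q) (δ q σ ρ)

module _ {n : ℕ} {A : TwoWayAutomaton n} (H : Hesitant A) where
  open TwoWayAutomaton A
  open Hesitant H

  Polarised : Set
  Polarised = ∀ q →
    (kind (component q) ≡ existential → q ∉ˢ F) ×
    (kind (component q) ≡ universal   → q ∈ˢ F)

-- Two-way HTA±: the subscript ± stands for polarisation.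
record HTA± (n : ℕ) : Set where
  field
    automaton : TwoWayAutomaton n
    hesitant  : Hesitant automaton
    polarised : Polarised hesitant

Linear : ∀ {n} → HTA± n → Set
Linear A = Injective _≡_ _≡_ (Hesitant.component (HTA±.hesitant A))

𝓛-HTA : ∀ {n} → HTA± n → Pred (ΣTree n) (lsuc 0ℓ)
𝓛-HTA A = 𝓛-automaton (HTA±.automaton A)

{-# OPTIONS --safe #-}
-- Every subformula occurrence χ gets a state ⊕ for χ and a dual state ⊖ for ¬ χ, and Boolean
-- connectives are absorbed into the transitions.  Only until and since formulae loop, by
--   q = δ(ψ) ∨ (δ(φ) ∧ (◇₁ or ⇑) q)    and dually    q̄ = δ(¬ψ) ∧ (δ(¬φ) ∨ (□₁ or "root or ⇑") q̄),
-- and F consists of the ⊖ states.  If φ holds, the unfolding of the triples (state, node,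
-- length of a witnessing path) is a run, and it is accepting because outside F the pair
-- (subformula, length) decreases lexicographically.  Conversely, an accepting run cannot stay in
-- a ⊕ state forever, so every until and since it asserts is fulfilled, while a ⊖ state is
-- propagated along any path that would witness the until or since it denies.
module Submission where

open import Defs
open import Axiom.ExcludedMiddle using (ExcludedMiddle)
open import Data.Bool.Base using (true; false; if_then_else_)
open import Data.Empty using (⊥; ⊥-elim)
open import Data.Fin.Base using (Fin; zero; suc; toℕ; _↑ˡ_; _↑ʳ_; splitAt; opposite) renaming (_<_ to _<ᶠ_; _≤_ to _≤ᶠ_; _>_ to _>ᶠ_)
open import Data.Fin.Induction using (>-wellFounded)
open import Data.Fin.Properties using (_≟_; pigeonhole; opposite-prop; opposite-involutive; splitAt-↑ˡ; splitAt-↑ʳ; join-splitAt; toℕ-↑ˡ; toℕ-↑ʳ) renaming (<⇒≢ to <ᶠ⇒≢)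
open import Data.Fin.Subset using (Subset; Side; inside; outside) renaming (_∈_ to _∈ˢ_; _∉_ to _∉ˢ_)
open import Data.Fin.Subset.Properties using (_∈?_)
open import Data.List.Base using (List; []; _∷_; _++_; length; tabulate; cartesianProductWith)
open import Data.List.Membership.Propositional using (_∈_; _∉_)
open import Data.List.Membership.Propositional.Properties using (∈-tabulate⁺)
open import Data.List.Properties using (length-tabulate; length-filter; filter-none; filter-++)
open import Data.List.Relation.Unary.All as All using (All; []; _∷_)
open import Data.List.Relation.Unary.All.Properties using (++⁺; ++⁻; all-filter; filter⁺; cartesianProductWith⁺)
open import Data.List.Relation.Unary.Any using (here; index)
open import Data.List.Membership.Setoid.Properties using (index-injective)
open import Data.Nat.Base using (ℕ; zero; suc; _+_; _∸_; _≤_; _<_; z≤n; s≤s; s<s; z<s)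
open import Data.Nat.Induction using (<-wellFounded)
open import Data.Nat.Properties using (≤-refl; ≤-reflexive; ≤-trans; <-≤-trans; <⇒≤; n≤1+n; n<1+n; ∸-monoʳ-≤; +-monoʳ-<; <-trans; m+[n∸m]≡n)
open import Data.Product.Base using (Σ-syntax; ∃-syntax; _×_; _,_; proj₁; proj₂; map₂)
open import Data.Sum.Base using (_⊎_; inj₁; inj₂; [_,_]; [_,_]′)
open import Data.Vec.Base using () renaming (tabulate to tabulateᵛ)
open import Data.Vec.Properties using ([]=⇒lookup; lookup⇒[]=; lookup∘tabulate)
open import Function.Base using (id; _∘_; flip; const)
open import Function.Definitions using (Injective)
open import Induction.WellFounded using (Acc; acc)
open import Level using (0ℓ)
open import Relation.Binary.Construct.Closure.ReflexiveTransitive using (Star; ε; _◅_; _◅◅_)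
open import Relation.Binary.Core using (Rel)
open import Relation.Binary.PropositionalEquality using (_≡_; _≢_; refl; sym; trans; cong; subst; setoid)
open import Relation.Nullary using (¬_; yes; no; does; contradiction)
open import Relation.Nullary.Decidable using (decidable-stable)
open import Relation.Unary using (Pred; _≐_)

-- Counting

module _ {A : Set} where

  atLeast-one : ∀ {P : Pred A 0ℓ} {a} → P a → AtLeast 1 P
  atLeast-one {a = a} p = const a , (λ { {zero} {zero} _ → refl }) , const p

  atLeast-suc : ∀ {k} {P : Pred A 0ℓ} {a} ((f , _) : AtLeast k P) →
    P a → a ∉ tabulate f → AtLeast (suc k) P
  atLeast-suc {k} {P} {a} (f , inj , p) pa a∉f = f′ , inj′ , p′
    where
    f′ : Fin (suc k) → A
    f′ zero    = a
    f′ (suc i) = f i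

    inj′ : Injective _≡_ _≡_ f′
    inj′ {zero}  {zero}  _  = refl
    inj′ {zero}  {suc j} eq = contradiction (subst (_∈ tabulate f) (sym eq) (∈-tabulate⁺ j)) a∉f
    inj′ {suc i} {zero}  eq = contradiction (subst (_∈ tabulate f) eq (∈-tabulate⁺ i)) a∉f
    inj′ {suc i} {suc j} eq = cong suc (inj eq)

    p′ : ∀ i → P (f′ i)
    p′ zero    = pa
    p′ (suc i) = p i

  allBut-one : ∀ {P R : Pred A 0ℓ} → (∀ {a} → P a → R a) → AllButFewerThan 1 P R
  allBut-one g = [] , z<s , λ _ p _ → g p

  allBut-one⁻ : ∀ {P R : Pred A 0ℓ} → AllButFewerThan 1 P R → ∀ {a} → P a → R a
  allBut-one⁻ ([] , _ , g)          p = g _ p λ ()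
  allBut-one⁻ (_ ∷ _ , s<s () , _) _

  allBut-map : ∀ {k} {P R R′ : Pred A 0ℓ} → (∀ {a} → R a → R′ a) →
    AllButFewerThan k P R → AllButFewerThan k P R′
  allBut-map g (E , E<k , h) = E , E<k , λ a p a∉E → g (h a p a∉E)

  module _ (em : ExcludedMiddle 0ℓ) {P R : Pred A 0ℓ} where

    -- If a family of `k` elements exists but none of `suc k`, its values exhaust the elements of
    -- `P` satisfying `R`, so they can be the exceptions. If not even `k` exist, the induction
    -- hypothesis gives a shorter list.
    ¬atLeast⇒allBut : ∀ k → ¬ AtLeast k (λ a → P a × R a) → AllButFewerThan k P (λ a → ¬ R a)
    ¬atLeast⇒allBut zero    ¬p = ⊥-elim (¬p ((λ ()) , (λ { {()} }) , λ ()))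
    ¬atLeast⇒allBut (suc k) ¬p with em {AtLeast k (λ a → P a × R a)}
    ... | yes fs@(f , _) = tabulate f , s≤s (≤-reflexive (length-tabulate f)) ,
                           λ a p a∉f r → ¬p (atLeast-suc fs (p , r) a∉f)
    ... | no ¬fs with E , E<k , g ← ¬atLeast⇒allBut k ¬fs = E , ≤-trans E<k (n≤1+n k) , g

    -- An element of `P` satisfying `R` must be an exception, so the `k` values of `f` occupy fewer
    -- than `k` positions of `E`; two share a position, against injectivity.
    allBut⇒¬atLeast : ∀ k → AllButFewerThan k P (λ a → ¬ R a) → ¬ AtLeast k (λ a → P a × R a)
    allBut⇒¬atLeast k (E , E<k , g) (f , inj , pr) =
      let i , j , i<j , eq = pigeonhole E<k (index ∘ f∈E)
      in <ᶠ⇒≢ i<j (inj (index-injective (setoid A) (f∈E i) (f∈E j) eq))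
      where
      f∈E : ∀ i → f i ∈ E
      f∈E i = decidable-stable em λ f∉E → g (f i) (proj₁ (pr i)) f∉E (proj₂ (pr i))

-- Paths

module Until {A : Set} (_⇝_ : Rel A 0ℓ) (P R : Pred A 0ℓ) where

  -- `PathUntil` is `∃[ j ] PathUntilIn j` by definition; exposing the length `j` lets it serve as a
  -- rank.
  PathUntilIn : ℕ → Pred A 0ℓ
  PathUntilIn j u =
    Σ[ w ∈ (ℕ → A) ] w 0 ≡ u × (∀ k → k < j → (w k ⇝ w (suc k)) × P (w k)) × R (w j)

  now : ∀ {u} → R u → PathUntil _⇝_ P R u
  now {u} r = 0 , const u , refl , (λ _ ()) , r

  later : ∀ {u v} → P u → u ⇝ v → PathUntil _⇝_ P R v → PathUntil _⇝_ P R u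
  later {u} p u⇝v (j , w , refl , steps , r) = suc j , w′ , refl , steps′ , r
    where
    w′ : ℕ → A
    w′ zero    = u
    w′ (suc k) = w k

    steps′ : ∀ k → k < suc j → (w′ k ⇝ w′ (suc k)) × P (w′ k)
    steps′ zero    _         = u⇝v , p
    steps′ (suc k) (s<s k<j) = steps k k<j

  zero⁻ : ∀ {u} → PathUntilIn 0 u → R u
  zero⁻ (_ , refl , _ , r) = r

  suc⁻ : ∀ {j u} → PathUntilIn (suc j) u →
    P u × ∃[ v ] u ⇝ v × PathUntilIn j v
  suc⁻ (w , refl , steps , r) =
    let w₀⇝w₁ , p = steps 0 z<s
    in p , w 1 , w₀⇝w₁ , w ∘ suc , refl , (λ k k<j → steps (suc k) (s<s k<j)) , r

module _ {A : Set} {_⇝_ : Rel A 0ℓ} where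

  -- Acceptance constrains only infinite paths from the root, so an infinite path found deeper in a
  -- run has to be extended backwards; `m` is the offset at which it reappears.
  prepend : ∀ {u v} → Star _⇝_ u v → (π : ℕ → A) → π 0 ≡ v → (∀ i → π i ⇝ π (suc i)) →
    Σ[ π′ ∈ (ℕ → A) ] π′ 0 ≡ u × (∀ i → π′ i ⇝ π′ (suc i)) ×
    ∃[ m ] ∀ i → π′ (m + i) ≡ π i
  prepend ε            π π₀ steps = π , π₀ , steps , 0 , λ _ → refl
  prepend {u} (e ◅ es) π π₀ steps with prepend es π π₀ steps
  ... | π′ , refl , steps′ , m , eq = π″ , refl , steps″ , suc m , eq
    where
    π″ : ℕ → A
    π″ zero    = u
    π″ (suc i) = π′ i

    steps″ : ∀ i → π″ i ⇝ π″ (suc i)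
    steps″ zero    = e
    steps″ (suc i) = steps′ i

-- Unfolding a relation into a tree

module Unfolding {C : Set} (_⇝_ : Rel C 0ℓ) (c₀ : C) where

  -- Histories: pairing a configuration with one makes its parent unique, even where `_⇝_` merges or
  -- cycles.
  data Path : C → Set where
    start : Path c₀
    _▷_   : ∀ {c d} → Path c → c ⇝ d → Path d

  data _⟶′_ : Rel (Σ[ c ∈ C ] Path c) 0ℓ where
    extend : ∀ {c d} (p : Path c) (s : c ⇝ d) → (c , p) ⟶′ (d , p ▷ s)

  unfold : Tree
  unfold = record
    { Node          = Σ[ c ∈ C ] Path c
    ; root          = c₀ , start
    ; _⟶_           = _⟶′_
    ; root-orphan   = λ ()
    ; parent-unique = λ { (extend _ _) (extend _ _) → refl }
    ; reachable     = λ (_ , p) → reach p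
    }
    where
    reach : ∀ {c} (p : Path c) → Star _⟶′_ (c₀ , start) (c , p)
    reach start   = ε
    reach (p ▷ s) = reach p ◅◅ (extend p s ◅ ε)

-- Positive Boolean formulae and their normal forms

module _ {A : Set} {P P′ : Pred A 0ℓ} (f : ∀ a → P a → P′ a) where

  holds-map : ∀ b → Holds P b → Holds P′ b
  holds-map tt       _        = _
  holds-map (atom a) p        = f a p
  holds-map (b ∧ c)  (p , q)  = holds-map b p , holds-map c q
  holds-map (b ∨ c)  (inj₁ p) = inj₁ (holds-map b p)
  holds-map (b ∨ c)  (inj₂ q) = inj₂ (holds-map c q)

module _ {A : Set} {P : Pred A 0ℓ} where

  private
    product⁺ : ∀ {xss yss} → All (All P) xss → All (All P) yss →
      All (All P) (cartesianProductWith _++_ xss yss)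
    product⁺ ps qs = cartesianProductWith⁺ (setoid _) (setoid _) _++_ _ _
      λ x∈ y∈ → ++⁺ (All.lookup ps x∈) (All.lookup qs y∈)

  dnf⁺ : ∀ b → All P (atoms b) → All (All P) (dnf b)
  dnf⁺ tt       _  = [] ∷ []
  dnf⁺ ff       _  = []
  dnf⁺ (atom _) ps = ps ∷ []
  dnf⁺ (b ∧ c)  ps = let p , q = ++⁻ (atoms b) ps in product⁺ (dnf⁺ b p) (dnf⁺ c q)
  dnf⁺ (b ∨ c)  ps = let p , q = ++⁻ (atoms b) ps in ++⁺ (dnf⁺ b p) (dnf⁺ c q)

  cnf⁺ : ∀ b → All P (atoms b) → All (All P) (cnf b)
  cnf⁺ tt       _  = []
  cnf⁺ ff       _  = [] ∷ []
  cnf⁺ (atom _) ps = ps ∷ []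
  cnf⁺ (b ∧ c)  ps = let p , q = ++⁻ (atoms b) ps in ++⁺ (cnf⁺ b p) (cnf⁺ c q)
  cnf⁺ (b ∨ c)  ps = let p , q = ++⁻ (atoms b) ps in product⁺ (cnf⁺ b p) (cnf⁺ c q)

-- States

-- The state ⊕ (⊖) of a subformula accepts where the subformula holds (fails).
data Polarity : Set where
  ⊕ ⊖ : Polarity

∓_ : Polarity → Polarity
∓ ⊕ = ⊖
∓ ⊖ = ⊕

private
  variable
    n N : ℕ

-- The summand 2 counts the two polarities. It stands outside the case distinction so that
-- `Fin (size χ)` exposes its first two elements even for a variable `χ`.
rest size : PastCTL± n → ℕ
size φ = 2 + rest φ

rest (prop _)   = 0
rest (neg φ)    = size φ
rest (φ or ψ)   = size φ + size ψ
rest (D _ φ)    = size φ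
rest (EX φ)     = size φ
rest E[ φ U ψ ] = size φ + size ψ
rest (EY φ)     = size φ
rest E[ φ S ψ ] = size φ + size ψ

top : ∀ {m} → Polarity → Fin (2 + m)
top ⊕ = zero
top ⊖ = suc zero

below : ∀ {m} → (Fin (2 + m) → Fin N) → Fin m → Fin N
below e i = e (suc (suc i))

left : ∀ (φ ψ : PastCTL± n) → (Fin (2 + (size φ + size ψ)) → Fin N) → Fin (size φ) → Fin N
left φ ψ e i = below e (i ↑ˡ size ψ)

right : ∀ (φ ψ : PastCTL± n) → (Fin (2 + (size φ + size ψ)) → Fin N) → Fin (size ψ) → Fin N
right φ ψ e i = below e (size φ ↑ʳ i)

-- Subformulae are tracked by occurrence: `embedding` gives the global numbers of the states that
-- belong to this one.
record Occurrence (n N : ℕ) : Set where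
  constructor occ
  field
    formula   : PastCTL± n
    polarity  : Polarity
    embedding : Fin (size formula) → Fin N

open Occurrence

-- States are numbered in preorder: the two of `χ` itself, then those of its operands from left to
-- right. Operands thus get larger numbers, which will give the order of the components.
decode : ∀ (χ : PastCTL± n) → (Fin (size χ) → Fin N) → Fin (size χ) → Occurrence n N
decode χ          e zero          = occ χ ⊕ e
decode χ          e (suc zero)    = occ χ ⊖ e
decode (neg φ)    e (suc (suc i)) = decode φ (below e) i
decode (φ or ψ)   e (suc (suc i)) = [ decode φ (left φ ψ e) , decode ψ (right φ ψ e) ]′ (splitAt (size φ) i)
decode (D _ φ)    e (suc (suc i)) = decode φ (below e) i
decode (EX φ)     e (suc (suc i)) = decode φ (below e) i
decode E[ φ U ψ ] e (suc (suc i)) = [ decode φ (left φ ψ e) , decode ψ (right φ ψ e) ]′ (splitAt (size φ) i)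
decode (EY φ)     e (suc (suc i)) = decode φ (below e) i
decode E[ φ S ψ ] e (suc (suc i)) = [ decode φ (left φ ψ e) , decode ψ (right φ ψ e) ]′ (splitAt (size φ) i)

decode-top : ∀ (χ : PastCTL± n) (e : Fin (size χ) → Fin N) b → decode χ e (top b) ≡ occ χ b e
decode-top χ e ⊕ = refl
decode-top χ e ⊖ = refl

Increasing : ∀ {m} → (Fin m → Fin N) → Set
Increasing e = ∀ {i j} → i <ᶠ j → e i <ᶠ e j

module _ {m} {e : Fin (2 + m) → Fin N} (inc : Increasing e) where

  below-increasing : Increasing (below e)
  below-increasing i<j = inc (s<s (s<s i<j))

  top<below : ∀ b i → e (top b) <ᶠ below e i
  top<below ⊕ _ = inc z<s
  top<below ⊖ _ = inc (s<s z<s)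

module _ (φ ψ : PastCTL± n) {e : Fin (2 + (size φ + size ψ)) → Fin N} (inc : Increasing e) where

  left-increasing : Increasing (left φ ψ e)
  left-increasing {i} {j} i<j = below-increasing inc lt
    where
    lt : (i ↑ˡ size ψ) <ᶠ (j ↑ˡ size ψ)
    lt rewrite toℕ-↑ˡ i (size ψ) | toℕ-↑ˡ j (size ψ) = i<j

  right-increasing : Increasing (right φ ψ e)
  right-increasing {i} {j} i<j = below-increasing inc lt
    where
    lt : (size φ ↑ʳ i) <ᶠ (size φ ↑ʳ j)
    lt rewrite toℕ-↑ʳ (size φ) i | toℕ-↑ʳ (size φ) j = +-monoʳ-< (size φ) i<j

-- Transitions

-- The dual of `⇑`: at the root there is no parent that could violate the obligation.
weakUp : Position → Fin N → 𝓑⁺ (Atom (Fin N))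
weakUp atRoot  q = tt
weakUp nonRoot q = atom (⇑ q)

-- Every atom moves to another node, so operands to be evaluated at the current node are inlined as
-- transitions, and only modalities name the state of an operand. The state to loop on is
-- `e (top b)`.
transition : Polarity → (χ : PastCTL± n) → (Fin (size χ) → Fin N) →
  Subset n → Position → 𝓑⁺ (Atom (Fin N))
transition ⊕ (prop p)   e σ ρ = if does (p ∈? σ) then tt else ff
transition ⊖ (prop p)   e σ ρ = if does (p ∈? σ) then ff else tt
transition b (neg φ)    e σ ρ = transition (∓ b) φ (below e) σ ρ
transition ⊕ (φ or ψ)   e σ ρ = transition ⊕ φ (left φ ψ e) σ ρ ∨ transition ⊕ ψ (right φ ψ e) σ ρ
transition ⊖ (φ or ψ)   e σ ρ = transition ⊖ φ (left φ ψ e) σ ρ ∧ transition ⊖ ψ (right φ ψ e) σ ρ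
transition ⊕ (D k φ)    e σ ρ = atom (◇ k (below e (top ⊕)))
transition ⊖ (D k φ)    e σ ρ = atom (□ k (below e (top ⊖)))
transition ⊕ (EX φ)     e σ ρ = atom (◇ 1 (below e (top ⊕)))
transition ⊖ (EX φ)     e σ ρ = atom (□ 1 (below e (top ⊖)))
transition ⊕ E[ φ U ψ ] e σ ρ =
  transition ⊕ ψ (right φ ψ e) σ ρ ∨ (transition ⊕ φ (left φ ψ e) σ ρ ∧ atom (◇ 1 (e (top ⊕))))
transition ⊖ E[ φ U ψ ] e σ ρ =
  transition ⊖ ψ (right φ ψ e) σ ρ ∧ (transition ⊖ φ (left φ ψ e) σ ρ ∨ atom (□ 1 (e (top ⊖))))
transition ⊕ (EY φ)     e σ ρ = atom (⇑ (below e (top ⊕)))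
transition ⊖ (EY φ)     e σ ρ = weakUp ρ (below e (top ⊖))
transition ⊕ E[ φ S ψ ] e σ ρ =
  transition ⊕ ψ (right φ ψ e) σ ρ ∨ (transition ⊕ φ (left φ ψ e) σ ρ ∧ atom (⇑ (e (top ⊕))))
transition ⊖ E[ φ S ψ ] e σ ρ =
  transition ⊖ ψ (right φ ψ e) σ ρ ∧ (transition ⊖ φ (left φ ψ e) σ ρ ∨ weakUp ρ (e (top ⊖)))

-- Kinds and shapes of transitions

kindOf : Polarity → PastCTL± n → Kind
kindOf ⊕ E[ _ U _ ] = existential
kindOf ⊖ E[ _ U _ ] = universal
kindOf _ E[ _ S _ ] = upward
kindOf _ _          = transient

accepting : Polarity → Side
accepting ⊕ = outside
accepting ⊖ = inside

Loop : Kind → Fin N → Pred (Atom (Fin N)) 0ℓ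
Loop transient   q a = ⊥
Loop existential q a = a ≡ ◇ 1 q
Loop universal   q a = a ≡ □ 1 q
Loop upward      q a = a ≡ ⇑ q

Beyond : Fin N → Pred (Atom (Fin N)) 0ℓ
Beyond q a = q <ᶠ target a

-- The bound on internal atoms per clause depends on the syntax and not just on the atoms, so the
-- two until shapes record where their only loop atom stands. For the other kinds the atoms suffice.
data Shape (q : Fin N) : Kind → 𝓑⁺ (Atom (Fin N)) → Set where
  transient   : ∀ {b} → All (Beyond q) (atoms b) → Shape q transient b
  existential : ∀ {c d} → All (Beyond q) (atoms c) → All (Beyond q) (atoms d) →
                Shape q existential (c ∨ (d ∧ atom (◇ 1 q)))
  universal   : ∀ {c d} → All (Beyond q) (atoms c) → All (Beyond q) (atoms d) →
                Shape q universal (c ∧ (d ∨ atom (□ 1 q)))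
  upward      : ∀ {b} → All (λ a → Beyond q a ⊎ Loop upward q a) (atoms b) → Shape q upward b

shape⇒loops : ∀ {q : Fin N} {k b} → Shape q k b →
  All (λ a → Beyond q a ⊎ Loop k q a) (atoms b)
shape⇒loops (transient p)     = All.map inj₁ p
shape⇒loops (existential p r) = ++⁺ (All.map inj₁ p) (++⁺ (All.map inj₁ r) (inj₂ refl ∷ []))
shape⇒loops (universal p r)   = ++⁺ (All.map inj₁ p) (++⁺ (All.map inj₁ r) (inj₂ refl ∷ []))
shape⇒loops (upward p)        = p

loop-target : ∀ k {q : Fin N} {a} → Loop k q a → target a ≡ q
loop-target existential refl = refl
loop-target universal   refl = refl
loop-target upward      refl = refl

shape⇒≥ : ∀ {q : Fin N} {k b} → Shape q k b → All (λ a → q ≤ᶠ target a) (atoms b)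
shape⇒≥ {k = k} s =
  All.map [ <⇒≤ , (λ l → ≤-reflexive (cong toℕ (sym (loop-target k l)))) ] (shape⇒loops s)

weakUp-atoms : ∀ {P : Pred (Atom (Fin N)) 0ℓ} ρ {q} → P (⇑ q) → All P (atoms (weakUp ρ q))
weakUp-atoms atRoot  p = []
weakUp-atoms nonRoot p = p ∷ []

-- A loop inside an inlined operand returns to the operand's state, which lies strictly beyond the
-- outer one; only the outermost loop still counts as a loop. Hence the mutual recursion with
-- `transition-beyond`.
transition-shape : ∀ b (χ : PastCTL± n) (e : Fin (size χ) → Fin N) → Increasing e → ∀ σ ρ →
  Shape (e (top b)) (kindOf b χ) (transition b χ e σ ρ)
transition-beyond : ∀ b (χ : PastCTL± n) (e : Fin (size χ) → Fin N) → Increasing e → ∀ σ ρ →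
  ∀ {q} → q <ᶠ e (top b) → All (Beyond q) (atoms (transition b χ e σ ρ))

transition-shape ⊕ (prop p)   e inc σ ρ with does (p ∈? σ)
... | true  = transient []
... | false = transient []
transition-shape ⊖ (prop p)   e inc σ ρ with does (p ∈? σ)
... | true  = transient []
... | false = transient []
transition-shape ⊕ (neg φ)    e inc σ ρ =
  transient (transition-beyond ⊖ φ _ (below-increasing inc) σ ρ (top<below inc ⊕ _))
transition-shape ⊖ (neg φ)    e inc σ ρ =
  transient (transition-beyond ⊕ φ _ (below-increasing inc) σ ρ (top<below inc ⊖ _))
transition-shape ⊕ (φ or ψ)   e inc σ ρ = transient (++⁺
  (transition-beyond ⊕ φ _ (left-increasing φ ψ inc) σ ρ (top<below inc ⊕ _))
  (transition-beyond ⊕ ψ _ (right-increasing φ ψ inc) σ ρ (top<below inc ⊕ _)))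
transition-shape ⊖ (φ or ψ)   e inc σ ρ = transient (++⁺
  (transition-beyond ⊖ φ _ (left-increasing φ ψ inc) σ ρ (top<below inc ⊖ _))
  (transition-beyond ⊖ ψ _ (right-increasing φ ψ inc) σ ρ (top<below inc ⊖ _)))
transition-shape ⊕ (D _ φ)    e inc σ ρ = transient (top<below inc ⊕ _ ∷ [])
transition-shape ⊖ (D _ φ)    e inc σ ρ = transient (top<below inc ⊖ _ ∷ [])
transition-shape ⊕ (EX φ)     e inc σ ρ = transient (top<below inc ⊕ _ ∷ [])
transition-shape ⊖ (EX φ)     e inc σ ρ = transient (top<below inc ⊖ _ ∷ [])
transition-shape ⊕ E[ φ U ψ ] e inc σ ρ = existential
  (transition-beyond ⊕ ψ _ (right-increasing φ ψ inc) σ ρ (top<below inc ⊕ _))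
  (transition-beyond ⊕ φ _ (left-increasing φ ψ inc) σ ρ (top<below inc ⊕ _))
transition-shape ⊖ E[ φ U ψ ] e inc σ ρ = universal
  (transition-beyond ⊖ ψ _ (right-increasing φ ψ inc) σ ρ (top<below inc ⊖ _))
  (transition-beyond ⊖ φ _ (left-increasing φ ψ inc) σ ρ (top<below inc ⊖ _))
transition-shape ⊕ (EY φ)     e inc σ ρ = transient (top<below inc ⊕ _ ∷ [])
transition-shape ⊖ (EY φ)     e inc σ ρ = transient (weakUp-atoms ρ (top<below inc ⊖ _))
transition-shape ⊕ E[ φ S ψ ] e inc σ ρ = upward (++⁺
  (All.map inj₁ (transition-beyond ⊕ ψ _ (right-increasing φ ψ inc) σ ρ (top<below inc ⊕ _)))
  (++⁺ (All.map inj₁ (transition-beyond ⊕ φ _ (left-increasing φ ψ inc) σ ρ (top<below inc ⊕ _)))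
       (inj₂ refl ∷ [])))
transition-shape ⊖ E[ φ S ψ ] e inc σ ρ = upward (++⁺
  (All.map inj₁ (transition-beyond ⊖ ψ _ (right-increasing φ ψ inc) σ ρ (top<below inc ⊖ _)))
  (++⁺ (All.map inj₁ (transition-beyond ⊖ φ _ (left-increasing φ ψ inc) σ ρ (top<below inc ⊖ _)))
       (weakUp-atoms ρ (inj₂ refl))))

transition-beyond b χ e inc σ ρ q<top =
  All.map (<-≤-trans q<top) (shape⇒≥ (transition-shape b χ e inc σ ρ))

-- The automaton

opposite-mono-≤ : ∀ {i j : Fin N} → i ≤ᶠ j → opposite j ≤ᶠ opposite i
opposite-mono-≤ {N} {i} {j} i≤j rewrite opposite-prop i | opposite-prop j = ∸-monoʳ-≤ N (s≤s i≤j)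

opposite-injective : Injective _≡_ _≡_ (opposite {N})
opposite-injective {x = i} {j} eq =
  trans (sym (opposite-involutive i)) (trans (cong opposite eq) (opposite-involutive j))

module Construction (Φ : PastCTL± n) where

  table : Fin (size Φ) → Occurrence n (size Φ)
  table = decode Φ id

  -- `δ` looks occurrences up in `table`, whereas proofs recurse on formulae. `coherent` ties the
  -- two together: reading the table through `e` agrees with decoding `χ` locally.
  record Placed (χ : PastCTL± n) (e : Fin (size χ) → Fin (size Φ)) : Set where
    constructor placed
    field
      coherent   : ∀ i → table (e i) ≡ decode χ e i
      increasing : Increasing e

  open Placed public

  placed-top : ∀ {χ e} → Placed χ e → ∀ b → table (e (top b)) ≡ occ χ b e
  placed-top {χ} {e} pl b = trans (coherent pl (top b)) (decode-top χ e b)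

  placed-whole : Placed Φ id
  placed-whole = placed (λ _ → refl) id

  operand : ∀ φ {e : Fin (2 + size φ) → Fin (size Φ)} → (∀ i → table (below e i) ≡ decode φ (below e) i) →
    Increasing e → Placed φ (below e)
  operand φ coh inc = placed coh (below-increasing inc)

  operands : ∀ φ ψ {e : Fin (2 + (size φ + size ψ)) → Fin (size Φ)} →
    (∀ i → table (below e i) ≡
           [ decode φ (left φ ψ e) , decode ψ (right φ ψ e) ]′ (splitAt (size φ) i)) →
    Increasing e → Placed φ (left φ ψ e) × Placed ψ (right φ ψ e)
  operands φ ψ {e} coh inc =
    placed (λ i → trans (coh _) (cong split (splitAt-↑ˡ (size φ) i (size ψ)))) (left-increasing φ ψ inc) ,
    placed (λ i → trans (coh _) (cong split (splitAt-↑ʳ (size φ) (size ψ) i))) (right-increasing φ ψ inc)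
    where
    split : Fin (size φ) ⊎ Fin (size ψ) → Occurrence n (size Φ)
    split = [ decode φ (left φ ψ e) , decode ψ (right φ ψ e) ]′

  placed-neg : ∀ φ {e} → Placed (neg φ) e → Placed φ (below e)
  placed-neg φ pl = operand φ (λ i → coherent pl (suc (suc i))) (increasing pl)

  placed-D : ∀ k φ {e} → Placed (D k φ) e → Placed φ (below e)
  placed-D _ φ pl = operand φ (λ i → coherent pl (suc (suc i))) (increasing pl)

  placed-EX : ∀ φ {e} → Placed (EX φ) e → Placed φ (below e)
  placed-EX φ pl = operand φ (λ i → coherent pl (suc (suc i))) (increasing pl)

  placed-EY : ∀ φ {e} → Placed (EY φ) e → Placed φ (below e)
  placed-EY φ pl = operand φ (λ i → coherent pl (suc (suc i))) (increasing pl)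

  placed-or : ∀ φ ψ {e} → Placed (φ or ψ) e → Placed φ (left φ ψ e) × Placed ψ (right φ ψ e)
  placed-or φ ψ pl = operands φ ψ (λ i → coherent pl (suc (suc i))) (increasing pl)

  placed-EU : ∀ φ ψ {e} → Placed E[ φ U ψ ] e → Placed φ (left φ ψ e) × Placed ψ (right φ ψ e)
  placed-EU φ ψ pl = operands φ ψ (λ i → coherent pl (suc (suc i))) (increasing pl)

  placed-ES : ∀ φ ψ {e} → Placed E[ φ S ψ ] e → Placed φ (left φ ψ e) × Placed ψ (right φ ψ e)
  placed-ES φ ψ pl = operands φ ψ (λ i → coherent pl (suc (suc i))) (increasing pl)

  Locates : Fin (size Φ) → Occurrence n (size Φ) → Set
  Locates q (occ χ b e) = Placed χ e × e (top b) ≡ q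

  -- The recursion of `decode` always ends at one of the first two indices of a placed subformula.
  -- Every state therefore has the form `e (top b)`, and facts proved for that form cover all of
  -- them.
  decode-locates : ∀ χ {e} → Placed χ e → ∀ i → Locates (e i) (decode χ e i)
  split-locates : ∀ φ ψ e → Placed φ (left φ ψ e) × Placed ψ (right φ ψ e) →
    ∀ i → Locates (below e i) ([ decode φ (left φ ψ e) , decode ψ (right φ ψ e) ]′ (splitAt (size φ) i))

  decode-locates χ              pl zero          = pl , refl
  decode-locates χ              pl (suc zero)    = pl , refl
  decode-locates (neg φ)        pl (suc (suc i)) = decode-locates φ (placed-neg φ pl) i
  decode-locates (φ or ψ)   {e} pl (suc (suc i)) = split-locates φ ψ e (placed-or φ ψ pl) i
  decode-locates (D k φ)        pl (suc (suc i)) = decode-locates φ (placed-D k φ pl) i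
  decode-locates (EX φ)         pl (suc (suc i)) = decode-locates φ (placed-EX φ pl) i
  decode-locates E[ φ U ψ ] {e} pl (suc (suc i)) = split-locates φ ψ e (placed-EU φ ψ pl) i
  decode-locates (EY φ)         pl (suc (suc i)) = decode-locates φ (placed-EY φ pl) i
  decode-locates E[ φ S ψ ] {e} pl (suc (suc i)) = split-locates φ ψ e (placed-ES φ ψ pl) i

  split-locates φ ψ e (l , r) i with splitAt (size φ) i | join-splitAt (size φ) (size ψ) i
  ... | inj₁ j | refl = decode-locates φ l j
  ... | inj₂ j | refl = decode-locates ψ r j

  table-locates : ∀ q → Locates q (table q)
  table-locates = decode-locates Φ placed-whole

  automaton : TwoWayAutomaton n
  automaton = record
    { size = size Φ
    ; δ    = λ q → transition (polarity (table q)) (formula (table q)) (embedding (table q))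
    ; qI   = top ⊕
    ; F    = tabulateᵛ (accepting ∘ polarity ∘ table)
    }

  open TwoWayAutomaton automaton using (Q; δ; F)

  stateKind : Q → Kind
  stateKind q = kindOf (polarity (table q)) (formula (table q))

  δ-shape : ∀ q σ ρ → Shape q (stateKind q) (δ q σ ρ)
  δ-shape q σ ρ =
    let pl , eq = table-locates q
    in subst (λ q′ → Shape q′ (stateKind q) (δ q σ ρ)) eq
         (transition-shape (polarity (table q)) (formula (table q)) _ (increasing pl) σ ρ)

  -- Transitions lead to larger states, so the components are numbered backwards.
  components : Components automaton
  components = record
    { #components = size Φ
    ; component   = opposite
    ; nonempty    = λ i → opposite i , λ { refl → opposite-involutive i }
    ; kind        = stateKind ∘ opposite
    }

  open Components components using (component; internal; WellFormed)

  -- Hesitancy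

  module _ {q : Q} where

    internal-none : ∀ {as} → All (Beyond q) as → internal (component q) as ≡ []
    internal-none = filter-none _ ∘ All.map λ q<a eq → <ᶠ⇒≢ q<a (sym (opposite-injective eq))

    -- Components are singletons, so an internal atom targets `q` itself and cannot be beyond `q`;
    -- only the loop alternative is left.
    internal-all : ∀ {R : Pred (Atom Q) 0ℓ} k → (∀ {a} → Loop k q a → R a) →
      ∀ {as} → All (λ a → Beyond q a ⊎ Loop k q a) as → All R (internal (component q) as)
    internal-all k f {as} ps = All.zipWith
      (λ { (eq , inj₁ q<a) → contradiction (sym (opposite-injective eq)) (<ᶠ⇒≢ q<a)
         ; (_  , inj₂ l)   → f l })
      (all-filter _ as , filter⁺ _ ps)

    Clause : Pred (List (Atom Q)) 0ℓ
    Clause as = length (internal (component q) as) ≤ 1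

    beyond-clauses : ∀ {ass} → All (All (Beyond q)) ass → All Clause ass
    beyond-clauses = All.map λ ps → ≤-trans (≤-reflexive (cong length (internal-none ps))) z≤n

    -- With `ass` the clauses of `d`, the product is `dnf (d ∧ atom a)` or `cnf (d ∨ atom a)`: each
    -- clause has no internal atom except possibly the appended `a`.
    loop-clauses : ∀ {ass} a → All (All (Beyond q)) ass →
      All Clause (cartesianProductWith _++_ ass ((a ∷ []) ∷ []))
    loop-clauses {ass} a ps = cartesianProductWith⁺ (setoid _) (setoid _) _++_ ass _
      λ { {as} as∈ (here refl) →
          subst (λ l → length l ≤ 1)
            (sym (trans (filter-++ _ as (a ∷ [])) (cong (_++ _) (internal-none (All.lookup ps as∈)))))
            (length-filter (λ a → component (target a) ≟ component q) (a ∷ [])) }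

    shape⇒wellFormed : ∀ {k b} → Shape q k b → WellFormed k (component q) b
    shape⇒wellFormed (transient p) = internal-none p
    shape⇒wellFormed s@(existential {c} {d} p r) =
      internal-all existential (λ { refl → refl }) (shape⇒loops s) ,
      ++⁺ (beyond-clauses (dnf⁺ c p)) (loop-clauses _ (dnf⁺ d r))
    shape⇒wellFormed s@(universal {c} {d} p r) =
      internal-all universal (λ { refl → refl }) (shape⇒loops s) ,
      ++⁺ (beyond-clauses (cnf⁺ c p)) (loop-clauses _ (cnf⁺ d r))
    shape⇒wellFormed s@(upward p) =
      (λ _ _ eq eq′ → opposite-injective (trans eq (sym eq′))) ,
      internal-all upward (λ { refl → refl }) (shape⇒loops s)

  hesitant : Hesitant automaton
  hesitant = record
    { components = components
    ; descending = λ q σ ρ → All.map opposite-mono-≤ (shape⇒≥ (δ-shape q σ ρ))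
    -- `kind` recovers the state from its component by a second `opposite`, which the involution
    -- cancels.
    ; wellFormed = λ q σ ρ → subst (λ q′ → WellFormed (stateKind q′) (component q) (δ q σ ρ))
        (sym (opposite-involutive q)) (shape⇒wellFormed (δ-shape q σ ρ))
    }

  -- Polarisation

  ⊖⇒∈F : ∀ {q} → polarity (table q) ≡ ⊖ → q ∈ˢ F
  ⊖⇒∈F {q} eq = lookup⇒[]= q F (trans (lookup∘tabulate (accepting ∘ polarity ∘ table) q) (cong accepting eq))

  ⊕⇒∉F : ∀ {q} → polarity (table q) ≡ ⊕ → q ∉ˢ F
  ⊕⇒∉F {q} eq q∈F
    with () ← trans (sym (cong accepting eq)) (trans (sym (lookup∘tabulate (accepting ∘ polarity ∘ table) q)) ([]=⇒lookup q∈F))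

  existential⇒⊕ : ∀ b (χ : PastCTL± n) → kindOf b χ ≡ existential → b ≡ ⊕
  existential⇒⊕ ⊕ χ _ = refl
  existential⇒⊕ ⊖ (prop _) ()
  existential⇒⊕ ⊖ (neg _) ()
  existential⇒⊕ ⊖ (_ or _) ()
  existential⇒⊕ ⊖ (D _ _) ()
  existential⇒⊕ ⊖ (EX _) ()
  existential⇒⊕ ⊖ E[ _ U _ ] ()
  existential⇒⊕ ⊖ (EY _) ()
  existential⇒⊕ ⊖ E[ _ S _ ] ()

  universal⇒⊖ : ∀ b (χ : PastCTL± n) → kindOf b χ ≡ universal → b ≡ ⊖
  universal⇒⊖ ⊖ χ _ = refl
  universal⇒⊖ ⊕ (prop _) ()
  universal⇒⊖ ⊕ (neg _) ()
  universal⇒⊖ ⊕ (_ or _) ()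
  universal⇒⊖ ⊕ (D _ _) ()
  universal⇒⊖ ⊕ (EX _) ()
  universal⇒⊖ ⊕ E[ _ U _ ] ()
  universal⇒⊖ ⊕ (EY _) ()
  universal⇒⊖ ⊕ E[ _ S _ ] ()

  polarised : Polarised hesitant
  polarised q rewrite opposite-involutive q =
    ⊕⇒∉F ∘ existential⇒⊕ _ (formula (table q)) , ⊖⇒∈F ∘ universal⇒⊖ _ (formula (table q))

  hta : HTA± n
  hta = record { automaton = automaton ; hesitant = hesitant ; polarised = polarised }

  linear : Linear hta
  linear = opposite-injective

-- Correctness

-- A view to be matched together with `position t v`: it yields a parent in the case `nonRoot` and
-- the equation with the root otherwise.
data Located (t : ΣTree n) (v : ΣTree.Node t) : Position → Set where
  at-root  : v ≡ ΣTree.root t → Located t v atRoot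
  below-of : ∀ {u} → ΣTree._⟶_ t u v → Located t v nonRoot

located : ∀ (t : ΣTree n) v → Located t v (position t v)
located t v with ΣTree.root? t v
... | yes v≡root = at-root v≡root
... | no  v≢root = below-of (proj₂ (parent (ΣTree.reachable t v) v≢root))
  where
  open ΣTree t using (_⟶_; root)
  parent : ∀ {u w} → Star _⟶_ u w → w ≢ u → ∃[ x ] x ⟶ w
  parent ε            w≢u = contradiction refl w≢u
  parent (e ◅ ε)      _   = _ , e
  parent (_ ◅ e ◅ es) _   = last e es
    where
    last : ∀ {u v w} → u ⟶ v → Star _⟶_ v w → ∃[ x ] x ⟶ w
    last e ε        = _ , e
    last _ (e ◅ es) = last e es

module Correctness (em : ExcludedMiddle 0ℓ) (Φ : PastCTL± n) (t : ΣTree n) where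
  open Construction Φ
  open TwoWayAutomaton automaton using (Q; δ; F)
  open ΣTree t

  module EU (φ ψ : PastCTL± n) = Until _⟶_ (Sat t φ) (Sat t ψ)
  module ES (φ ψ : PastCTL± n) = Until (flip _⟶_) (Sat t φ) (Sat t ψ)

  Sat± : Polarity → PastCTL± n → Pred Node 0ℓ
  Sat± ⊕ χ v = Sat t χ v
  Sat± ⊖ χ v = ¬ Sat t χ v

  -- The semantics of atoms with `HasChild` generalised to any `G`, so that the same lemmas serve
  -- truth in `t` (with `Next`) and runs (with `HasChild`).
  AtomSat : (Q → Pred Node 0ℓ) → Node → Pred (Atom Q) 0ℓ
  AtomSat G v (◇ k q) = AtLeast k (λ v′ → v ⟶ v′ × G q v′)
  AtomSat G v (□ k q) = AllButFewerThan k (v ⟶_) (G q)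
  AtomSat G v (⇑ q)   = ∃[ u ] u ⟶ v × G q u

  atomSat-map : ∀ {G G′ : Q → Pred Node 0ℓ} {v} → (∀ {q v} → G q v → G′ q v) →
    ∀ a → AtomSat G v a → AtomSat G′ v a
  atomSat-map f (◇ k q) = λ (vs , inj , g) → vs , inj , map₂ f ∘ g
  atomSat-map f (□ k q) = allBut-map f
  atomSat-map f (⇑ q)   = λ (u , u⟶v , g) → u , u⟶v , f g

  weakUp⁺ : ∀ (G : Q → Pred Node 0ℓ) {v} q → (∀ {u} → u ⟶ v → G q u) →
    Holds (AtomSat G v) (weakUp (position t v) q)
  weakUp⁺ G {v} q g with position t v | located t v
  ... | atRoot  | _            = _
  ... | nonRoot | below-of u⟶v = _ , u⟶v , g u⟶v

  -- `⇑` speaks of some parent; parents being unique, this covers all of them, and the root has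
  -- none.
  weakUp⁻ : ∀ (G : Q → Pred Node 0ℓ) {v} q → Holds (AtomSat G v) (weakUp (position t v) q) →
    ∀ {u} → u ⟶ v → G q u
  weakUp⁻ G {v} q h u⟶v with position t v | located t v
  ... | atRoot  | at-root refl = contradiction u⟶v root-orphan
  ... | nonRoot | _ with u′ , u′⟶v , g ← h = subst (G q) (parent-unique u′⟶v u⟶v) g

  -- The rank is the length of a witnessing path; it bounds how often a run can stay in
  -- the state of an until or since formula.
  Ranked : Polarity → PastCTL± n → ℕ → Pred Node 0ℓ
  Ranked ⊕ E[ φ U ψ ] k v = EU.PathUntilIn φ ψ k v
  Ranked ⊕ E[ φ S ψ ] k v = ES.PathUntilIn φ ψ k v
  Ranked b χ          k v = Sat± b χ v

  rank : ∀ b χ {v} → Sat± b χ v → ∃[ k ] Ranked b χ k v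
  rank ⊕ (prop _)   s = 0 , s
  rank ⊕ (neg _)    s = 0 , s
  rank ⊕ (_ or _)   s = 0 , s
  rank ⊕ (D _ _)    s = 0 , s
  rank ⊕ (EX _)     s = 0 , s
  rank ⊕ E[ _ U _ ] s = s
  rank ⊕ (EY _)     s = 0 , s
  rank ⊕ E[ _ S _ ] s = s
  rank ⊖ (prop _)   s = 0 , s
  rank ⊖ (neg _)    s = 0 , s
  rank ⊖ (_ or _)   s = 0 , s
  rank ⊖ (D _ _)    s = 0 , s
  rank ⊖ (EX _)     s = 0 , s
  rank ⊖ E[ _ U _ ] s = 0 , s
  rank ⊖ (EY _)     s = 0 , s
  rank ⊖ E[ _ S _ ] s = 0 , s

  RankedState : Q → ℕ → Pred Node 0ℓ
  RankedState q = Ranked (polarity (table q)) (formula (table q))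

  -- The steps that do not endanger acceptance: to a larger state, or around a loop whose state is
  -- in `F` (polarity `⊖`) or which lowers the rank.
  Progress : Polarity → Q → ℕ → Q → ℕ → Set
  Progress b q k q′ k′ = q <ᶠ q′ ⊎ (q ≡ q′ × (b ≡ ⊖ ⊎ k′ < k))

  -- What is needed to add a child labelled `(q′ , v)` to the run under construction.
  record Next (b : Polarity) (q : Q) (k : ℕ) (q′ : Q) (v : Node) : Set where
    constructor next
    field
      rank′    : ℕ
      ranked   : RankedState q′ rank′ v
      progress : Progress b q k q′ rank′

  next-self : ∀ b {χ e} → Placed χ e → ∀ {k′ v} → Ranked b χ k′ v → ∀ {k} → (b ≡ ⊖ ⊎ k′ < k) →
    Next b (e (top b)) k (e (top b)) v
  next-self b pl {k′} {v} r pr = next k′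
    (subst (λ o → Ranked (polarity o) (formula o) k′ v) (sym (placed-top pl b)) r) (inj₂ (refl , pr))

  next-sub : ∀ b {χ e} → Placed χ e → ∀ {v b₀ q₀ k₀} → q₀ <ᶠ e (top b) → Sat± b χ v →
    Next b₀ q₀ k₀ (e (top b)) v
  next-sub b {χ} pl {v} q₀< s with k , r ← rank b χ s = next k
    (subst (λ o → Ranked (polarity o) (formula o) k v) (sym (placed-top pl b)) r) (inj₁ q₀<)

  diamond : ∀ {b q k q′ v v′} → v ⟶ v′ → Next b q k q′ v′ → AtomSat (Next b q k) v (◇ 1 q′)
  diamond {b} {q} {k} {q′} {v} v⟶v′ x = atLeast-one {P = λ v′ → v ⟶ v′ × Next b q k q′ v′} (v⟶v′ , x)

  Allowed : Polarity → Q → ℕ → Node → 𝓑⁺ (Atom Q) → Set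
  Allowed b q k v = Holds (AtomSat (Next b q k) v)

  -- The truth value of `χ` selects the disjunct to satisfy, and the obligations this leaves at
  -- neighbouring nodes are true again, so a run can be continued from every node.
  step-allowed : ∀ b χ e → Placed χ e → ∀ {k v} → Ranked b χ k v →
    Allowed b (e (top b)) k v (transition b χ e (label v) (position t v))
  -- Whatever an inlined operand asks for, even a loop on its own state, leads strictly beyond the
  -- outer state `q₀` and so is progress regardless of ranks.
  sub-allowed : ∀ b {χ e} → Placed χ e → ∀ {v b₀ q₀ k₀} → q₀ <ᶠ e (top b) → Sat± b χ v →
    Allowed b₀ q₀ k₀ v (transition b χ e (label v) (position t v))

  step-allowed ⊕ (prop p) e pl {v = v} s with p ∈? label v
  ... | yes _ = _
  ... | no ¬p = ¬p s
  step-allowed ⊖ (prop p) e pl {v = v} s with p ∈? label v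
  ... | yes p∈ = s p∈
  ... | no _   = _
  step-allowed ⊕ (neg φ) e pl s =
    sub-allowed ⊖ (placed-neg φ pl) (top<below (increasing pl) ⊕ _) s
  step-allowed ⊖ (neg φ) e pl s =
    sub-allowed ⊕ (placed-neg φ pl) (top<below (increasing pl) ⊖ _) (decidable-stable em s)
  step-allowed ⊕ (φ or ψ) e pl (inj₁ s) =
    inj₁ (sub-allowed ⊕ (proj₁ (placed-or φ ψ pl)) (top<below (increasing pl) ⊕ _) s)
  step-allowed ⊕ (φ or ψ) e pl (inj₂ s) =
    inj₂ (sub-allowed ⊕ (proj₂ (placed-or φ ψ pl)) (top<below (increasing pl) ⊕ _) s)
  step-allowed ⊖ (φ or ψ) e pl s =
    sub-allowed ⊖ (proj₁ (placed-or φ ψ pl)) (top<below (increasing pl) ⊖ _) (s ∘ inj₁) ,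
    sub-allowed ⊖ (proj₂ (placed-or φ ψ pl)) (top<below (increasing pl) ⊖ _) (s ∘ inj₂)
  step-allowed ⊕ (D k φ) e pl (vs , inj , s) =
    vs , inj , map₂ (next-sub ⊕ (placed-D k φ pl) (top<below (increasing pl) ⊕ _)) ∘ s
  step-allowed ⊖ (D k φ) e pl s =
    allBut-map (next-sub ⊖ (placed-D k φ pl) (top<below (increasing pl) ⊖ _)) (¬atLeast⇒allBut em k s)
  step-allowed ⊕ (EX φ) e pl (_ , v⟶v′ , s) =
    diamond v⟶v′ (next-sub ⊕ (placed-EX φ pl) (top<below (increasing pl) ⊕ _) s)
  step-allowed ⊖ (EX φ) e pl s = allBut-one λ v⟶v′ →
    next-sub ⊖ (placed-EX φ pl) (top<below (increasing pl) ⊖ _) λ s′ → s (_ , v⟶v′ , s′)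
  -- A path of length 0 gives `ψ` here and now; a longer one has a tail of rank one less, which pays
  -- for the loop.
  step-allowed ⊕ E[ φ U ψ ] e pl {zero} s =
    inj₁ (sub-allowed ⊕ (proj₂ (placed-EU φ ψ pl)) (top<below (increasing pl) ⊕ _) (EU.zero⁻ φ ψ s))
  step-allowed ⊕ E[ φ U ψ ] e pl {suc k} s with p , _ , v⟶v′ , s′ ← EU.suc⁻ φ ψ s = inj₂
    ( sub-allowed ⊕ (proj₁ (placed-EU φ ψ pl)) (top<below (increasing pl) ⊕ _) p
    , diamond v⟶v′ (next-self ⊕ pl s′ (inj₂ (n<1+n k))))
  step-allowed ⊖ E[ φ U ψ ] e pl {k} {v} s =
    sub-allowed ⊖ (proj₂ (placed-EU φ ψ pl)) (top<below (increasing pl) ⊖ _) (s ∘ EU.now φ ψ) ,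
    continue
    where
    continue : Allowed ⊖ (e (top ⊖)) k v
      (transition ⊖ φ (left φ ψ e) (label v) (position t v) ∨ atom (□ 1 (e (top ⊖))))
    -- Where `φ` holds, no child satisfies the until formula, since its path could be prolonged to
    -- `v`; the loop goes on. Where `φ` fails, it stops.
    continue with em {Sat t φ v}
    ... | yes p = inj₂ (allBut-one λ v⟶v′ →
      -- Rank 0 is a default: a `⊖` state is in `F`, so its loop has no rank to lower.
      next-self ⊖ pl {0} (s ∘ EU.later φ ψ p v⟶v′) (inj₁ refl))
    ... | no ¬p = inj₁ (sub-allowed ⊖ (proj₁ (placed-EU φ ψ pl)) (top<below (increasing pl) ⊖ _) ¬p)
  step-allowed ⊕ (EY φ) e pl (_ , u⟶v , s) =
    _ , u⟶v , next-sub ⊕ (placed-EY φ pl) (top<below (increasing pl) ⊕ _) s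
  step-allowed ⊖ (EY φ) e pl {k} s = weakUp⁺ (Next ⊖ (e (top ⊖)) k) _ λ u⟶v →
    next-sub ⊖ (placed-EY φ pl) (top<below (increasing pl) ⊖ _) λ s′ → s (_ , u⟶v , s′)
  step-allowed ⊕ E[ φ S ψ ] e pl {zero} s =
    inj₁ (sub-allowed ⊕ (proj₂ (placed-ES φ ψ pl)) (top<below (increasing pl) ⊕ _) (ES.zero⁻ φ ψ s))
  step-allowed ⊕ E[ φ S ψ ] e pl {suc k} s with p , _ , u⟶v , s′ ← ES.suc⁻ φ ψ s = inj₂
    ( sub-allowed ⊕ (proj₁ (placed-ES φ ψ pl)) (top<below (increasing pl) ⊕ _) p
    , _ , u⟶v , next-self ⊕ pl s′ (inj₂ (n<1+n k)))
  step-allowed ⊖ E[ φ S ψ ] e pl {k} {v} s =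
    sub-allowed ⊖ (proj₂ (placed-ES φ ψ pl)) (top<below (increasing pl) ⊖ _) (s ∘ ES.now φ ψ) ,
    continue
    where
    continue : Allowed ⊖ (e (top ⊖)) k v
      (transition ⊖ φ (left φ ψ e) (label v) (position t v) ∨ weakUp (position t v) (e (top ⊖)))
    continue with em {Sat t φ v}
    ... | yes p = inj₂ (weakUp⁺ (Next ⊖ (e (top ⊖)) k) _ λ u⟶v →
      next-self ⊖ pl {0} (s ∘ ES.later φ ψ p u⟶v) (inj₁ refl))
    ... | no ¬p = inj₁ (sub-allowed ⊖ (proj₁ (placed-ES φ ψ pl)) (top<below (increasing pl) ⊖ _) ¬p)

  sub-allowed b {χ} {e} pl {v} {b₀} {q₀} {k₀} q₀< s with k , r ← rank b χ s =
    holds-map (atomSat-map weaken) (transition b χ e (label v) (position t v)) (step-allowed b χ e pl r)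
    where
    weaken : ∀ {k q v} → Next b (e (top b)) k q v → Next b₀ q₀ k₀ q v
    weaken (next k r (inj₁ lt))         = next k r (inj₁ (<-trans q₀< lt))
    weaken (next k r (inj₂ (refl , _))) = next k r (inj₁ q₀<)

  δ-allowed : ∀ q {k v} → RankedState q k v →
    Allowed (polarity (table q)) q k v (δ q (label v) (position t v))
  δ-allowed q {k} {v} r =
    let pl , eq = table-locates q
    in subst (λ q′ → Allowed (polarity (table q)) q′ k v (δ q (label v) (position t v))) eq
         (step-allowed (polarity (table q)) (formula (table q)) _ pl r)

  -- From truth to an accepting run

  module Completeness where

    record Config : Set where
      constructor config
      field
        state     : Q
        node      : Node
        rankᶜ     : ℕ
        satisfied : RankedState state rankᶜ node

    open Config

    _⇝_ : Rel Config 0ℓ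
    c ⇝ d = Progress (polarity (table (state c))) (state c) (rankᶜ c) (state d) (rankᶜ d)

    sat⇒accepted : Sat t Φ root → 𝓛-HTA hta t
    sat⇒accepted s = run , accept
      where
      c₀ : Config
      c₀ = let k , r = rank ⊕ Φ s in config (top ⊕) root k r

      open Unfolding _⇝_ c₀

      runTree : LabelledTree automaton t
      runTree = record
        { runTree  = unfold
        ; runLabel = λ (c , _) → state c , node c
        }

      open LabelledTree runTree using (HasChild; _⊨_)

      hasChild : ∀ x → let c = proj₁ x in
        ∀ {q v} → Next (polarity (table (state c))) (state c) (rankᶜ c) q v → HasChild x q v
      hasChild (c , p) {q} {v} (next k r pr) = (config q v k r , p ▷ pr) , extend p pr , refl

      -- Both sides agree definitionally once the constructor of the atom is known.
      models : ∀ x a → AtomSat (HasChild x) (node (proj₁ x)) a → x ⊨ a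
      models x (◇ _ _) h = h
      models x (□ _ _) h = h
      models x (⇑ _)   h = h

      run : Run automaton t root
      run = record
        { labelledTree = runTree
        ; root-label   = refl
        ; consistent   = λ x@(c , _) →
            holds-map (λ a → models x a ∘ atomSat-map (hasChild x) a)
              (δ (state c) (label (node c)) (position t (node c))) (δ-allowed (state c) (satisfied c))
        }

      edge⇒⇝ : ∀ {x y} → x ⟶′ y → proj₁ x ⇝ proj₁ y
      edge⇒⇝ (extend _ s) = s

      -- Along a path the pair (state, rank) progresses lexicographically until F is visited.
      accept : Accepting automaton t run
      accept π _ steps i = visit i refl (>-wellFounded _) (<-wellFounded _)
        where
        Visit : ℕ → Set
        Visit i = ∃[ j ] i ≤ j × state (proj₁ (π j)) ∈ˢ F

        earlier : ∀ {i} → Visit (suc i) → Visit i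
        earlier (j , i<j , j∈F) = j , <⇒≤ i<j , j∈F

        -- The state is abstracted to `q` so that a step keeping it can reuse the same accessibility
        -- proof while the rank descends; a step to a larger state restarts the rank.
        visit : ∀ i {q} → state (proj₁ (π i)) ≡ q → Acc _>ᶠ_ q → Acc _<_ (rankᶜ (proj₁ (π i))) → Visit i
        visit-by : ∀ i → Acc _>ᶠ_ (state (proj₁ (π i))) → Acc _<_ (rankᶜ (proj₁ (π i))) →
          proj₁ (π i) ⇝ proj₁ (π (suc i)) → Visit i

        visit i refl a b = visit-by i a b (edge⇒⇝ (steps i))

        visit-by i (acc larger) _ (inj₁ lt) =
          earlier (visit (suc i) refl (larger lt) (<-wellFounded _))
        visit-by i _ _ (inj₂ (_ , inj₁ ⊖q)) = i , ≤-refl , ⊖⇒∈F ⊖q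
        visit-by i a (acc smaller) (inj₂ (eq , inj₂ lt)) =
          earlier (visit (suc i) (sym eq) a (smaller lt))

  -- From an accepting run to truth

  module Soundness (run : Run automaton t root) (acceptance : Accepting automaton t run) where
    open Run run

    -- Iterating the step would give an infinite path of the run that stays in `q` from some point
    -- on, and acceptance forbids this when `q` is not in `F`.
    eventually : ∀ {q} → q ∉ˢ F → (P : Pred R.Node 0ℓ) →
      (∀ {x} → P x → ∃[ y ] x R.⟶ y × state y ≡ q × P y) → ∀ {x} → ¬ P x
    eventually {q} q∉F P step {x} p = q∉F (subst (_∈ˢ F) q-at-j j∈F)
      where
      Looping : Set
      Looping = Σ[ y ∈ R.Node ] state y ≡ q × P y

      path : ℕ → Looping
      -- The chain begins one step after `x`, because `x` itself need not be in state `q`.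
      path zero    = let y , _ , eq , p′ = step p in y , eq , p′
      path (suc i) = let y , _ , eq , p′ = step (proj₂ (proj₂ (path i))) in y , eq , p′

      extended = prepend (R.reachable (proj₁ (path 0))) (proj₁ ∘ path) refl
        λ i → proj₁ (proj₂ (step (proj₂ (proj₂ (path i)))))

      π : ℕ → R.Node
      π = proj₁ extended

      m : ℕ
      m = proj₁ (proj₂ (proj₂ (proj₂ extended)))

      visit : ∃[ j ] m ≤ j × state (π j) ∈ˢ F
      -- Asking for a visit from `m` on skips the prefix from the root, so `π j` lies on the looping
      -- chain.
      visit = acceptance π (proj₁ (proj₂ extended)) (proj₁ (proj₂ (proj₂ extended))) m

      j   = proj₁ visit
      m≤j = proj₁ (proj₂ visit)
      j∈F = proj₂ (proj₂ visit)

      q-at-j : state (π j) ≡ q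
      q-at-j = trans
        (cong state (trans (cong π (sym (m+[n∸m]≡n m≤j))) (proj₂ (proj₂ (proj₂ (proj₂ extended))) (j ∸ m))))
        (proj₁ (proj₂ (path (j ∸ m))))

    -- Inlined operands have no run nodes of their own, so soundness is stated for a transition that
    -- holds at `x`, whatever the state of `x` is.
    Respects : R.Node → Polarity → (χ : PastCTL± n) → (Fin (size χ) → Q) → Set
    Respects x b χ e = Holds (x ⊨_) (transition b χ e (label (node x)) (position t (node x)))

    respects : ∀ b {χ e} → Placed χ e → ∀ {x} → state x ≡ e (top b) → Respects x b χ e
    respects b pl {x} eq =
      subst (λ o → Respects x (polarity o) (formula o) (embedding o))
        (trans (cong table eq) (placed-top pl b)) (consistent x)

    child-respects : ∀ b {χ e} → Placed χ e → ∀ {x v} → HasChild x (e (top b)) v →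
      ∃[ y ] x R.⟶ y × state y ≡ e (top b) × node y ≡ v × Respects y b χ e
    child-respects b pl (y , x⟶y , eq) =
      y , x⟶y , cong proj₁ eq , cong proj₂ eq , respects b pl (cong proj₁ eq)

    ⊕∉F : ∀ {χ e} → Placed χ e → e (top ⊕) ∉ˢ F
    ⊕∉F pl = ⊕⇒∉F (cong polarity (placed-top pl ⊕))

    models⁻ : ∀ x a → x ⊨ a → AtomSat (HasChild x) (node x) a
    models⁻ x (◇ _ _) h = h
    models⁻ x (□ _ _) h = h
    models⁻ x (⇑ _)   h = h

    parents : ∀ {x} q → Holds (x ⊨_) (weakUp (position t (node x)) q) →
      ∀ {u} → u ⟶ node x → HasChild x q u
    parents {x} q h = weakUp⁻ (HasChild x) q (holds-map (models⁻ x) (weakUp (position t (node x)) q) h)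

    sound : ∀ b χ {e} → Placed χ e → ∀ {x} → Respects x b χ e → Sat± b χ (node x)
    child-sound : ∀ b χ {e} → Placed χ e → ∀ {x v} → HasChild x (e (top b)) v → Sat± b χ v

    sound ⊕ (prop p) pl {x} h with p ∈? label (node x)
    ... | yes p∈ = p∈
    sound ⊖ (prop p) pl {x} h with p ∈? label (node x)
    ... | no p∉ = p∉
    sound ⊕ (neg φ) pl h = sound ⊖ φ (placed-neg φ pl) h
    sound ⊖ (neg φ) pl h ¬s = ¬s (sound ⊕ φ (placed-neg φ pl) h)
    sound ⊕ (φ or ψ) pl (inj₁ h) = inj₁ (sound ⊕ φ (proj₁ (placed-or φ ψ pl)) h)
    sound ⊕ (φ or ψ) pl (inj₂ h) = inj₂ (sound ⊕ ψ (proj₂ (placed-or φ ψ pl)) h)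
    sound ⊖ (φ or ψ) pl (h , _) (inj₁ s) = sound ⊖ φ (proj₁ (placed-or φ ψ pl)) h s
    sound ⊖ (φ or ψ) pl (_ , h) (inj₂ s) = sound ⊖ ψ (proj₂ (placed-or φ ψ pl)) h s
    sound ⊕ (D k φ) pl (vs , inj , h) = vs , inj , map₂ (child-sound ⊕ φ (placed-D k φ pl)) ∘ h
    sound ⊖ (D k φ) pl h =
      allBut⇒¬atLeast em k (allBut-map (child-sound ⊖ φ (placed-D k φ pl)) h)
    sound ⊕ (EX φ) pl (f , _ , h) =
      let v⟶v′ , y = h zero in f zero , v⟶v′ , child-sound ⊕ φ (placed-EX φ pl) y
    sound ⊖ (EX φ) pl h (_ , v⟶v′ , s) =
      child-sound ⊖ φ (placed-EX φ pl) (allBut-one⁻ h v⟶v′) s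
    -- While the until formula fails at the current node, the disjunct with `ψ` is impossible, so
    -- the transition must loop to a child where the formula fails again, and this never ends.
    sound ⊕ E[ φ U ψ ] {e} pl h = decidable-stable em λ ¬s → eventually (⊕∉F pl) Unfulfilled step (h , ¬s)
      where
      Unfulfilled : Pred R.Node 0ℓ
      Unfulfilled x = Respects x ⊕ E[ φ U ψ ] e × ¬ Sat t E[ φ U ψ ] (node x)

      step : ∀ {x} → Unfulfilled x → ∃[ y ] x R.⟶ y × state y ≡ e (top ⊕) × Unfulfilled y
      step (inj₁ h , ¬s) = contradiction (EU.now φ ψ (sound ⊕ ψ (proj₂ (placed-EU φ ψ pl)) h)) ¬s
      step (inj₂ (h , f , _ , g) , ¬s) with f zero | g zero
      ... | _ | v⟶v′ , c with y , x⟶y , eq , refl , h′ ← child-respects ⊕ pl c = y , x⟶y , eq , h′ ,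
        ¬s ∘ EU.later φ ψ (sound ⊕ φ (proj₁ (placed-EU φ ψ pl)) h) v⟶v′
    sound ⊖ E[ φ U ψ ] {e} pl h (j , s) = refute j h s
      where
      -- Induction on the length of the alleged path: its end contradicts the refutation of `ψ`;
      -- before that, either `φ` is refuted or the `⊖` state is handed to the next node of the path.
      refute : ∀ j {x} → Respects x ⊖ E[ φ U ψ ] e → ¬ EU.PathUntilIn φ ψ j (node x)
      refute zero    (h , _)      s = sound ⊖ ψ (proj₂ (placed-EU φ ψ pl)) h (EU.zero⁻ φ ψ s)
      refute (suc j) (_ , inj₁ h) s = sound ⊖ φ (proj₁ (placed-EU φ ψ pl)) h (proj₁ (EU.suc⁻ φ ψ s))
      refute (suc j) (_ , inj₂ h) s with _ , _ , v⟶v′ , s′ ← EU.suc⁻ φ ψ s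
        with _ , _ , _ , refl , h′ ← child-respects ⊖ pl (allBut-one⁻ h v⟶v′) = refute j h′ s′
    sound ⊕ (EY φ) pl (u , u⟶v , y) = u , u⟶v , child-sound ⊕ φ (placed-EY φ pl) y
    sound ⊖ (EY φ) pl h (_ , u⟶v , s) = child-sound ⊖ φ (placed-EY φ pl) (parents _ h u⟶v) s
    sound ⊕ E[ φ S ψ ] {e} pl h = decidable-stable em λ ¬s → eventually (⊕∉F pl) Unfulfilled step (h , ¬s)
      where
      Unfulfilled : Pred R.Node 0ℓ
      Unfulfilled x = Respects x ⊕ E[ φ S ψ ] e × ¬ Sat t E[ φ S ψ ] (node x)

      step : ∀ {x} → Unfulfilled x → ∃[ y ] x R.⟶ y × state y ≡ e (top ⊕) × Unfulfilled y
      step (inj₁ h , ¬s) = contradiction (ES.now φ ψ (sound ⊕ ψ (proj₂ (placed-ES φ ψ pl)) h)) ¬s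
      step (inj₂ (h , _ , u⟶v , c) , ¬s)
        with y , x⟶y , eq , refl , h′ ← child-respects ⊕ pl c = y , x⟶y , eq , h′ ,
        ¬s ∘ ES.later φ ψ (sound ⊕ φ (proj₁ (placed-ES φ ψ pl)) h) u⟶v
    sound ⊖ E[ φ S ψ ] {e} pl h (j , s) = refute j h s
      where
      -- The same induction along ancestors, with `parents` handing the `⊖` state to the parent.
      refute : ∀ j {x} → Respects x ⊖ E[ φ S ψ ] e → ¬ ES.PathUntilIn φ ψ j (node x)
      refute zero    (h , _)      s = sound ⊖ ψ (proj₂ (placed-ES φ ψ pl)) h (ES.zero⁻ φ ψ s)
      refute (suc j) (_ , inj₁ h) s = sound ⊖ φ (proj₁ (placed-ES φ ψ pl)) h (proj₁ (ES.suc⁻ φ ψ s))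
      refute (suc j) (_ , inj₂ h) s with _ , _ , u⟶v , s′ ← ES.suc⁻ φ ψ s
        with _ , _ , _ , refl , h′ ← child-respects ⊖ pl (parents _ h u⟶v) = refute j h′ s′

    child-sound b χ pl c with _ , _ , _ , refl , h ← child-respects b pl c = sound b χ pl h

  accepted⇒sat : 𝓛-HTA hta t → Sat t Φ root
  accepted⇒sat (run , acceptance) =
    subst (Sat t Φ) (cong proj₂ root-label) (sound ⊕ Φ placed-whole (respects ⊕ placed-whole (cong proj₁ root-label)))
    where
    open Soundness run acceptance
    open Run run using (root-label)

theorem5p2 : ExcludedMiddle 0ℓ → (n : ℕ) (φ : PastCTL± n) → Σ[ A ∈ HTA± n ] Linear A × 𝓛-formula φ ≐ 𝓛-HTA A
theorem5p2 em n φ =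
  Construction.hta φ , Construction.linear φ ,
  (λ {t} → Correctness.Completeness.sat⇒accepted em φ t) , (λ {t} → Correctness.accepted⇒sat em φ t)
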